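{- Let $\Gamma$ be a finite simple connected non-bipartite tetravalent $G$-half-arc-transitive graph (for some $G\le\mathrm{Aut}(\Gamma)$) of order greater than $12$ with $\mathrm{rad}_G(\Gamma)=3$ and $\mathrm{att}_G(\Gamma)=2$. Then there exist a $2$-fold covering projection $\wp\colon\Gamma\to\Gamma'$ and an arc-transitive group $H\le\mathrm{Aut}(\Gamma')$ which lifts along $\wp$ such that $\Gamma$ is a non-sectional $H$-split cover of $\Gamma'$.
   Context: For a tetravalent graph $\Gamma$ and $G\le \mathrm{Aut}(\Gamma)$, $\Gamma$ is $G$-half-arc-transitive if $G$ is transitive on vertices and edges but not on arcs; the $G$-orbits on arcs give two paired orientations in which every vertex is head of two and tail of two incident edges. A $G$-alternating cycle is a cycle in which consecutive edges share a head or share a tail; all have length $2\mathrm{rad}_G(\Gamma)$ and two non-disjoint ones meet in $\mathrm{att}_G(\Gamma)$ vertices. A covering projection $\wp\colon\tilde\Gamma\to\Gamma'$ of connected graphs is a surjective graph homomorphism that is a local bijection on neighbourhoods; it is $n$-fold if each fibre $\wp^{ -1}(v)$ has $n$ vertices; $\mathrm{CT}(\wp)$ is its group of covering transformations (automorphisms $\sigma$ of $\tilde\Gamma$ with $\wp\sigma=\wp$). A group $H\le\mathrm{Aut}(\Gamma')$ lifts along $\wp$ if every $h\in H$ has a lift $\tilde h\in\mathrm{Aut}(\tilde\Gamma)$ with $\wp\tilde h=h\wp$; the lifted group $\tilde H$ of all such lifts is an extension of $\mathrm{CT}(\wp)$ by $H$. $\wp$ is $H$-split if this extension splits, i.e.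 $\mathrm{CT}(\wp)$ has a complement in $\tilde H$. A complement $\bar H$ is sectional if there is a $\bar H$-invariant set of vertices of $\tilde\Gamma$ meeting each fibre of $\wp$ in exactly one vertex; an $H$-split cover is non-sectional if no complement of $\mathrm{CT}(\wp)$ in $\tilde H$ is sectional. -}

module Defs where

open import Level using (Level)
open import Data.Nat using (ℕ; zero; suc; _+_; _≤_; _<_)
open import Data.Nat.DivMod using (_%_; m%n<n)
open import Data.Fin using (Fin; toℕ; fromℕ<)
open import Data.Bool using (Bool; true; false)
open import Data.Product using (Σ; ∃; _×_; _,_)
open import Data.Sum using (_⊎_)
open import Relation.Nullary using (¬_)
open import Relation.Binary.PropositionalEquality using (_≡_; _≢_)
open import Function using (_∘_; id)
open import Function.Definitions using (Injective)

record Graph : Set where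
  field
    n      : ℕ
    adj    : Fin n → Fin n → Bool
    sym    : ∀ u v → adj u v ≡ adj v u
    irrefl : ∀ u → adj u u ≡ false

module _ (Γ : Graph) where
  open Graph Γ

  V : Set
  V = Fin n

  E : V → V → Set
  E u v = adj u v ≡ true

HasSize : {A : Set} → (A → Set) → ℕ → Set
HasSize {A} P k =
  Σ (Fin k → A) λ f → Injective _≡_ _≡_ f × (∀ i → P (f i))
    × (∀ a → P a → ∃ λ i → f i ≡ a)

_≗_ : {A B : Set} → (A → B) → (A → B) → Set
f ≗ g = ∀ x → f x ≡ g x

module _ (Γ : Graph) where
  open Graph Γ

  Order : ℕ
  Order = n

  Tetravalent : Set
  Tetravalent = ∀ (u : V Γ) → HasSize (E Γ u) 4

  data Reach : V Γ → V Γ → Set where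
    here  : ∀ {u} → Reach u u
    there : ∀ {u v w} → E Γ u v → Reach v w → Reach u w

  Connected : Set
  Connected = ∀ u v → Reach u v

  Bipartite : Set
  Bipartite = Σ (V Γ → Bool) λ c → ∀ u v → E Γ u v → c u ≢ c v

  IsAut : (V Γ → V Γ) → Set
  IsAut f = Σ (V Γ → V Γ) λ g → (g ∘ f) ≗ id × (f ∘ g) ≗ id
              × (∀ u v → adj (f u) (f v) ≡ adj u v)

  record IsSubgroupAut (P : (V Γ → V Γ) → Set) : Set where
    field
      auts    : ∀ f → P f → IsAut f
      respect : ∀ f g → f ≗ g → P f → P g
      hasId   : P id
      closed∘ : ∀ f g → P f → P g → P (f ∘ g)
      closedInv : ∀ f → P f → Σ (V Γ → V Γ) λ g → P g × (g ∘ f) ≗ id × (f ∘ g) ≗ id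

  module _ (G : (V Γ → V Γ) → Set) where

    VertexTransitive : Set
    VertexTransitive = ∀ u v → Σ _ λ g → G g × g u ≡ v

    ArcTransitive : Set
    ArcTransitive = ∀ u v x y → E Γ u v → E Γ x y →
      Σ _ λ g → G g × g u ≡ x × g v ≡ y

    EdgeTransitive : Set
    EdgeTransitive = ∀ u v x y → E Γ u v → E Γ x y →
      Σ _ λ g → G g × ((g u ≡ x × g v ≡ y) ⊎ (g u ≡ y × g v ≡ x))

    HalfArcTransitive : Set
    HalfArcTransitive = VertexTransitive × EdgeTransitive × ¬ ArcTransitive

    Orient : V Γ → V Γ → V Γ → V Γ → Set
    Orient u₀ v₀ x y = Σ _ λ g → G g × g u₀ ≡ x × g v₀ ≡ y

next : ∀ {k} → Fin (suc k) → Fin (suc k)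
next {k} i = fromℕ< (m%n<n (suc (toℕ i)) (suc k))

module _ (Γ : Graph) (G : (V Γ → V Γ) → Set) (u₀ v₀ : V Γ) where

  private
    D = Orient Γ G u₀ v₀

  -- A G-alternating cycle of length 2 (suc k) (w.r.t. the orientation D):
  --   t₀ → h₀ ← t₁ → h₁ ← ... t_k → h_k ← t₀
  -- with all 2(suc k) vertices distinct and suc k ≥ 2.
  record AltCycle (k : ℕ) : Set where
    field
      tl   : Fin (suc k) → V Γ
      hd   : Fin (suc k) → V Γ
      len≥4 : 1 ≤ k
      tl-inj : Injective _≡_ _≡_ tl
      hd-inj : Injective _≡_ _≡_ hd
      tl≢hd  : ∀ i j → tl i ≢ hd j
      out    : ∀ i → D (tl i) (hd i)
      inn    : ∀ i → D (tl (next i)) (hd i)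

  open AltCycle

  OnCycle : ∀ {k} → AltCycle k → V Γ → Set
  OnCycle C v = ∃ λ i → tl C i ≡ v ⊎ hd C i ≡ v

  ArcOf : ∀ {k} → AltCycle k → V Γ → V Γ → Set
  ArcOf C x y = ∃ λ i → (tl C i ≡ x × hd C i ≡ y) ⊎ (tl C (next i) ≡ x × hd C i ≡ y)

  RadIs : ℕ → Set
  RadIs r = ∀ k → AltCycle k → suc k ≡ r

  -- att_G(Γ) = a : any two distinct non-disjoint G-alternating cycles
  -- meet in exactly a vertices
  AttIs : ℕ → Set
  AttIs a = ∀ k k' (C : AltCycle k) (C' : AltCycle k') →
    (∃ λ x → ∃ λ y → ArcOf C x y × ¬ ArcOf C' x y) →
    (∃ λ v → OnCycle C v × OnCycle C' v) →
    HasSize (λ v → OnCycle C v × OnCycle C' v) a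

module _ (Γ~ Γ' : Graph) where

  record IsCovering (p : V Γ~ → V Γ') : Set where
    field
      surj  : ∀ x → ∃ λ u → p u ≡ x
      hom   : ∀ u v → E Γ~ u v → E Γ' (p u) (p v)
      locInj : ∀ u v w → E Γ~ u v → E Γ~ u w → p v ≡ p w → v ≡ w
      locSurj : ∀ u y → E Γ' (p u) y → ∃ λ v → E Γ~ u v × p v ≡ y

  module _ (p : V Γ~ → V Γ') where

    NFold : ℕ → Set
    NFold m = ∀ x → HasSize (λ u → p u ≡ x) m

    CT : (V Γ~ → V Γ~) → Set
    CT σ = IsAut Γ~ σ × (p ∘ σ) ≗ p

    module _ (H : (V Γ' → V Γ') → Set) where

      Lifts : Set
      Lifts = ∀ h → H h → Σ _ λ h~ → IsAut Γ~ h~ × (p ∘ h~) ≗ (h ∘ p)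

      Lifted : (V Γ~ → V Γ~) → Set
      Lifted a = IsAut Γ~ a × Σ _ λ h → H h × (p ∘ a) ≗ (h ∘ p)

      IsComplement : ((V Γ~ → V Γ~) → Set) → Set
      IsComplement K = IsSubgroupAut Γ~ K × (∀ k → K k → Lifted k)
        × (∀ k → K k → CT k → k ≗ id)
        × (∀ a → Lifted a → Σ _ λ k → Σ _ λ c → K k × CT c × a ≗ (k ∘ c))

      Split : Set₁
      Split = Σ _ IsComplement

      Sectional : ((V Γ~ → V Γ~) → Set) → Set₁
      Sectional K = Σ (V Γ~ → Set) λ S → (∀ k v → K k → S v → S (k v))
        × (∀ x → HasSize (λ u → S u × p u ≡ x) 1)

      NonSectionalSplit : Set₁
      NonSectionalSplit = Split × (∀ K → IsComplement K → ¬ Sectional K)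

{-# OPTIONS --safe #-}
module Submission where

-- A G-alternating hexagon C through v and the other one C' through v meet in v and one further
-- vertex. The elements of G fixing v and reflecting C preserve C', hence fix that vertex, which is
-- therefore antipodal to v in C, and likewise in C'. So v ↦ antipode of v is a well defined
-- involution σ commuting with G; it is an automorphism reversing the orientation. The cover is
-- Γ → Γ/σ, with H the group induced by G, so that G complements ⟨σ⟩.

open import Defs
open import Data.Bool using (Bool; true; false; not)
open import Data.Bool.Properties using (not-involutive; ¬-not) renaming (_≟_ to _≟ᵇ_)
open import Data.Empty using (⊥; ⊥-elim)
open import Data.Fin using (Fin; zero; suc; toℕ; fromℕ<)
open import Data.Fin.Patterns using (0F; 1F; 2F; 3F; 4F; 5F)
open import Data.Fin.Properties using (_≟_; any?; pigeonhole; suc-injective; toℕ-injective; toℕ-fromℕ<; toℕ<n)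
open import Data.Nat using (ℕ; zero; suc; _+_; _*_; _∸_; _≤_; _<_; z≤n; s≤s; s≤s⁻¹; _<?_)
open import Data.Nat.DivMod using (_%_; m%n<n; m<n⇒m%n≡m; n%n≡0)
open import Data.Nat.Induction using (<-rec)
open import Data.Nat.Properties using (≤-refl; ≤-trans; <⇒≤; <-asym; <-irrefl; <-cmp; m≤m+n; m≤n+m; m∸n≤m; m+n∸n≡m; m+[n∸m]≡n; m<n⇒0<n∸m; m≤n⇒m<n∨m≡n; ≤-<-trans; +-∸-assoc; +-suc; +-identityʳ; *-comm; *-distribʳ-+; anyUpTo?; ≮⇒≥)
open import Data.Product using (Σ; ∃; _×_; _,_; proj₁; proj₂)
open import Data.Sum using (_⊎_; inj₁; inj₂; [_,_])
open import Function using (_∘_; id)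
open import Function.Definitions using (Injective)
open import Relation.Binary.Definitions using (tri<; tri≈; tri>)
open import Relation.Binary.PropositionalEquality using (_≡_; _≢_; refl; sym; trans; cong; subst; subst₂)
open import Relation.Nullary using (¬_; Dec; yes; no; does; _×-dec_; ¬?)

-- `RadIs` and `AttIs` constrain alternating cycles without supplying any, so the hexagons have to
-- be built. In- and out-valency are two, hence an alternating walk is determined by its first arc,
-- and transitivity of `G` on the arcs of the orientation becomes transitivity on alternating walks
-- of a given length and first direction. Reflections and even translations of a walk are thus
-- realised in `G`; together with finiteness they force the walk to close up. `H` is arc-transitive
-- although `G` is not, because the two arc orbits of `G` are interchanged by σ and merge in the
-- quotient. The quotient is simple and the projection locally injective because a vertex adjacent
-- to both `v` and `σ v` would produce a forbidden coincidence on one hexagon or a third common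
-- vertex of two.

least : (Q : ℕ → Set) → (∀ k → Dec (Q k)) → ∀ m → Q m → ∃ λ r → Q r × (∀ j → j < r → ¬ Q j)
least Q Q? = <-rec _ step
  where
  step : ∀ m → (∀ {k} → k < m → Q k → ∃ λ r → Q r × (∀ j → j < r → ¬ Q j)) →
         Q m → ∃ λ r → Q r × (∀ j → j < r → ¬ Q j)
  step m rec q with anyUpTo? Q? m
  ... | yes (k , k<m , qk) = rec k<m qk
  ... | no none = m , q , λ j j<m qj → none (j , j<m , qj)

-- Listing `a` in front of the `n` values of `s` forces a collision, and injectivity leaves only one
-- that involves `a`.
injective⇒surjective : ∀ {n} {s : Fin n → Fin n} → Injective _≡_ _≡_ s → ∀ a → ∃ λ x → s x ≡ a
injective⇒surjective {n} {s} inj a with pigeonhole ≤-refl (λ { zero → a ; (suc x) → s x })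
... | zero  , suc x , _ , eq = x , sym eq
... | suc x , suc y , x<y , eq = ⊥-elim (<-irrefl (cong (suc ∘ toℕ) (inj eq)) x<y)

decidable⇒HasSize : ∀ {n} (P : Fin n → Set) → (∀ x → Dec (P x)) → ∃ (HasSize P)
decidable⇒HasSize {zero} P P? = 0 , (λ ()) , (λ {}) , (λ ()) , λ ()
decidable⇒HasSize {suc n} P P? with decidable⇒HasSize (P ∘ suc) (P? ∘ suc) | P? zero
... | m , f , inj , all , sur | no ¬p =
  m , suc ∘ f , inj ∘ suc-injective , all ,
  λ { zero p → ⊥-elim (¬p p) ; (suc a) p → proj₁ (sur a p) , cong suc (proj₂ (sur a p)) }
... | m , f , inj , all , sur | yes p =
  suc m , f⁺ , inj⁺ , (λ { zero → p ; (suc i) → all i }) ,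
  λ { zero _ → zero , refl ; (suc a) q → suc (proj₁ (sur a q)) , cong suc (proj₂ (sur a q)) }
  where
  f⁺ : Fin (suc m) → Fin (suc n)
  f⁺ zero = zero
  f⁺ (suc i) = suc (f i)
  inj⁺ : Injective _≡_ _≡_ f⁺
  inj⁺ {zero} {zero} _ = refl
  inj⁺ {suc i} {suc j} eq = cong suc (inj (suc-injective eq))

true⇔⇒≡ : ∀ {a b} → (a ≡ true → b ≡ true) → (b ≡ true → a ≡ true) → a ≡ b
true⇔⇒≡ {true}          f g = sym (f refl)
true⇔⇒≡ {false} {true}  f g = g refl
true⇔⇒≡ {false} {false} f g = refl

false≢true : false ≢ true
false≢true ()

does≡true⇒ : ∀ {A : Set} (a? : Dec A) → does a? ≡ true → A
does≡true⇒ (yes a) _ = a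

⇒does≡true : ∀ {A : Set} (a? : Dec A) → A → does a? ≡ true
⇒does≡true (yes _) _ = refl
⇒does≡true (no ¬a) a = ⊥-elim (¬a a)

-- Quotient of a finite set by a free involution.

module FreeInvolution {n : ℕ} (σ : Fin n → Fin n)
  (σσ : ∀ u → σ (σ u) ≡ u) (σ≢ : ∀ u → σ u ≢ u) where

  private
    -- As σ has no fixed point, exactly one element of each orbit has a smaller index than its
    -- image. It represents the orbit, so the quotient can be some `Fin size`.
    Lower : Fin n → Set
    Lower u = toℕ u < toℕ (σ u)

    lower : ∃ (HasSize Lower)
    lower = decidable⇒HasSize Lower (λ u → toℕ u <? toℕ (σ u))

  size : ℕ
  size = proj₁ lower

  rep : Fin size → Fin n
  rep = proj₁ (proj₂ lower)

  private
    rep-injective : Injective _≡_ _≡_ rep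
    rep-injective = proj₁ (proj₂ (proj₂ lower))

    rep-lower : ∀ x → Lower (rep x)
    rep-lower = proj₁ (proj₂ (proj₂ (proj₂ lower)))

    rep-unique : ∀ x y → rep x ≡ rep y ⊎ rep x ≡ σ (rep y) → x ≡ y
    rep-unique x y (inj₁ eq) = rep-injective eq
    rep-unique x y (inj₂ eq) = ⊥-elim (<-asym (rep-lower y) (subst₂ (λ a b → toℕ a < toℕ b)
      eq (trans (cong σ eq) (σσ (rep y))) (rep-lower x)))

    class : ∀ u → ∃ λ x → rep x ≡ u ⊎ rep x ≡ σ u
    class u with <-cmp (toℕ u) (toℕ (σ u))
    ... | tri< lt _ _ = let x , eq = proj₂ (proj₂ (proj₂ (proj₂ lower))) u lt in x , inj₁ eq
    ... | tri≈ _ eq _ = ⊥-elim (σ≢ u (sym (toℕ-injective eq)))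
    ... | tri> _ _ gt =
      let x , eq = proj₂ (proj₂ (proj₂ (proj₂ lower))) (σ u)
                     (subst (λ v → toℕ (σ u) < toℕ v) (sym (σσ u)) gt)
      in x , inj₂ eq

  p : Fin n → Fin size
  p = proj₁ ∘ class

  p-rep : ∀ x → p (rep x) ≡ x
  p-rep x = rep-unique _ _ (proj₂ (class (rep x)))

  p-σ : ∀ u → p (σ u) ≡ p u
  p-σ u with class u | class (σ u)
  ... | x , inj₁ e | y , inj₁ e' = rep-unique y x (inj₂ (trans e' (cong σ (sym e))))
  ... | x , inj₁ e | y , inj₂ e' = rep-unique y x (inj₁ (trans e' (trans (σσ u) (sym e))))
  ... | x , inj₂ e | y , inj₁ e' = rep-unique y x (inj₁ (trans e' (sym e)))
  ... | x , inj₂ e | y , inj₂ e' = rep-unique y x (inj₂ (trans e' (cong σ (sym e))))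

  p-fibre : ∀ u v → p u ≡ p v → u ≡ v ⊎ u ≡ σ v
  p-fibre u v eq with class u | class v | eq
  ... | x , inj₁ e | .x , inj₁ e' | refl = inj₁ (trans (sym e) e')
  ... | x , inj₁ e | .x , inj₂ e' | refl = inj₂ (trans (sym e) e')
  ... | x , inj₂ e | .x , inj₁ e' | refl = inj₂ (trans (sym (σσ u)) (cong σ (trans (sym e) e')))
  ... | x , inj₂ e | .x , inj₂ e' | refl =
    inj₁ (trans (sym (σσ u)) (trans (cong σ (trans (sym e) e')) (σσ v)))

  fibre-size : ∀ x → HasSize (λ u → p u ≡ x) 2
  fibre-size x = f , inj , (λ { 0F → p-rep x ; 1F → trans (p-σ _) (p-rep x) }) , sur
    where
    f : Fin 2 → Fin n
    f 0F = rep x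
    f 1F = σ (rep x)
    inj : Injective _≡_ _≡_ f
    inj {0F} {0F} _ = refl
    inj {0F} {1F} eq = ⊥-elim (σ≢ _ (sym eq))
    inj {1F} {0F} eq = ⊥-elim (σ≢ _ eq)
    inj {1F} {1F} _ = refl
    sur : ∀ u → p u ≡ x → ∃ λ i → f i ≡ u
    sur u eq with p-fibre u (rep x) (trans eq (sym (p-rep x)))
    ... | inj₁ e = 0F , sym e
    ... | inj₂ e = 1F , sym e

-- Direction of arc `k` in an alternating walk whose first direction is `b`. Flipping `b` before the
-- recursion makes `tail` and `drop` type-check without transport.
dir : Bool → ℕ → Bool
dir b zero    = b
dir b (suc k) = dir (not b) k

dir-not : ∀ b k → dir (not b) k ≡ not (dir b k)
dir-not b zero    = refl
dir-not b (suc k) = dir-not (not b) k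

dir-even : ∀ b k → dir b (k * 2) ≡ b
dir-even b zero    = refl
dir-even b (suc k) = trans (dir-even (not (not b)) k) (not-involutive b)

dir-+ : ∀ b i j → dir b (i + j) ≡ dir (dir b i) j
dir-+ b zero    j = refl
dir-+ b (suc i) j = dir-+ (not b) i j

dir-involutive : ∀ b k → dir (dir b k) k ≡ b
dir-involutive b zero    = refl
dir-involutive b (suc k) =
  trans (dir-not (dir (not b) k) k) (trans (cong not (dir-involutive (not b) k)) (not-involutive b))

-- The orientation defined by `G`, with in- and out-valency two.

module Orientation (Γ : Graph) (G : (V Γ → V Γ) → Set) (sub : IsSubgroupAut Γ G)
  (tet : Tetravalent Γ) (hat : HalfArcTransitive Γ G)
  (u₀ v₀ : V Γ) (e₀ : E Γ u₀ v₀) where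

  open Graph Γ using (n; adj)
  open IsSubgroupAut sub

  D : V Γ → V Γ → Set
  D = Orient Γ G u₀ v₀

  G-injective : ∀ {g} → G g → ∀ {x y} → g x ≡ g y → x ≡ y
  G-injective {g} Gg {x} {y} eq with h , _ , hg , _ ← closedInv g Gg =
    trans (sym (hg x)) (trans (cong h eq) (hg y))

  G-preserves-E : ∀ {g} → G g → ∀ {x y} → E Γ x y → E Γ (g x) (g y)
  G-preserves-E {g} Gg e = trans (proj₂ (proj₂ (proj₂ (auts g Gg))) _ _) e

  G-preserves-D : ∀ {g} → G g → ∀ {x y} → D x y → D (g x) (g y)
  G-preserves-D {g} Gg (h , Gh , hu , hv) = g ∘ h , closed∘ g h Gg Gh , cong g hu , cong g hv

  D-transitive : ∀ {x y x' y'} → D x y → D x' y' → Σ _ λ g → G g × g x ≡ x' × g y ≡ y'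
  D-transitive (h , Gh , refl , refl) (k , Gk , refl , refl) with h' , Gh' , h'h , _ ← closedInv h Gh =
    k ∘ h' , closed∘ k h' Gk Gh' , cong k (h'h u₀) , cong k (h'h v₀)

  D⇒E : ∀ {x y} → D x y → E Γ x y
  D⇒E (g , Gg , refl , refl) = G-preserves-E Gg e₀

  E-sym : ∀ {x y} → E Γ x y → E Γ y x
  E-sym {x} {y} e = trans (Graph.sym Γ y x) e

  E⇒D : ∀ {x y} → E Γ x y → D x y ⊎ D y x
  E⇒D {x} {y} e with proj₁ (proj₂ hat) u₀ v₀ x y e₀ e
  ... | g , Gg , inj₁ eqs = inj₁ (g , Gg , eqs)
  ... | g , Gg , inj₂ eqs = inj₂ (g , Gg , eqs)

  -- Otherwise `k' ∘ l` would reverse the arc from `u₀` to `v₀`, every arc would lie in `D`, and `G`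
  -- would be arc-transitive.
  D-asym : ∀ {x y} → D x y → ¬ D y x
  D-asym (k , Gk , refl , refl) (l , Gl , lu , lv) = proj₂ (proj₂ hat) λ _ _ _ _ e e' → D-transitive (allD e) (allD e')
    where
    allD : ∀ {a b} → E Γ a b → D a b
    allD e with E⇒D e | closedInv k Gk
    ... | inj₁ d | _ = d
    ... | inj₂ (g , Gg , gu , gv) | k' , Gk' , k'k , _ =
      g ∘ k' ∘ l , closed∘ g _ Gg (closed∘ k' l Gk' Gl) ,
      trans (cong g (trans (cong k' lu) (k'k v₀))) gv ,
      trans (cong g (trans (cong k' lv) (k'k u₀))) gu

  -- `G` is an arbitrary predicate, so group elements cannot be searched. On an edge, `E⇒D` names
  -- one orientation and `D-asym` excludes the other.
  D? : ∀ x y → Dec (D x y)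
  D? x y with adj x y in eq
  ... | false = no λ d → false≢true (trans (sym eq) (D⇒E d))
  ... | true with E⇒D eq
  ...   | inj₁ d = yes d
  ...   | inj₂ d = no λ d' → D-asym d' d

  -- Out- and in-neighbours under one name, so that a statement about alternating walks is proved
  -- once for both starting directions.
  R : Bool → V Γ → V Γ → Set
  R true  x y = D x y
  R false x y = D y x

  R? : ∀ b x y → Dec (R b x y)
  R? true  x y = D? x y
  R? false x y = D? y x

  flip : ∀ b {x y} → R b x y → R (not b) y x
  flip true  r = r
  flip false r = r

  unflip : ∀ b {x y} → R (not b) y x → R b x y
  unflip true  r = r
  unflip false r = r

  R-asym : ∀ b {x y} → R b x y → ¬ R (not b) x y
  R-asym true  r s = D-asym r s
  R-asym false r s = D-asym s r

  R⇒E : ∀ b {x y} → R b x y → E Γ x y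
  R⇒E true  r = D⇒E r
  R⇒E false r = E-sym (D⇒E r)

  E⇒R : ∀ b {x y} → E Γ x y → R b x y ⊎ R (not b) x y
  E⇒R true  e = E⇒D e
  E⇒R false e with E⇒D e
  ... | inj₁ d = inj₂ d
  ... | inj₂ d = inj₁ d

  G-preserves-R : ∀ b {g} → G g → ∀ {x y} → R b x y → R b (g x) (g y)
  G-preserves-R true  Gg r = G-preserves-D Gg r
  G-preserves-R false Gg r = G-preserves-D Gg r

  R-transitive : ∀ b {x y x' y'} → R b x y → R b x' y' → Σ _ λ g → G g × g x ≡ x' × g y ≡ y'
  R-transitive true  r s = D-transitive r s
  R-transitive false r s with g , Gg , p , q ← D-transitive r s = g , Gg , q , p

  neighbour : ∀ b v → ∃ λ y → R b v y
  neighbour true v with g , Gg , eq ← proj₁ hat u₀ v = g v₀ , g , Gg , eq , refl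
  neighbour false v with g , Gg , eq ← proj₁ hat v₀ v = g u₀ , g , Gg , refl , eq

  -- If b-neighbours were unique, x ↦ (b-neighbour of x) would be a surjection of a finite
  -- set onto itself, hence a bijection, and the graph would have valency 2.
  other : ∀ b {x y} → R b x y → ∃ λ z → R b x z × y ≢ z
  other b {x} {y} r with any? (λ z → R? b x z ×-dec ¬? (y ≟ z))
  ... | yes found = found
  ... | no none = ⊥-elim valency≤2
    where
    unique-at-x : ∀ {z} → R b x z → y ≡ z
    unique-at-x {z} s with y ≟ z
    ... | yes eq = eq
    ... | no y≢z = ⊥-elim (none (z , s , y≢z))

    unique : ∀ {w z z'} → R b w z → R b w z' → z ≡ z'
    unique {w} s s' with g , Gg , refl ← proj₁ hat w x =
      G-injective Gg (trans (sym (unique-at-x (G-preserves-R b Gg s))) (unique-at-x (G-preserves-R b Gg s')))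

    s : V Γ → V Γ
    s w = proj₁ (neighbour (not b) w)

    R-s : ∀ w → R b (s w) w
    R-s w = unflip b (proj₂ (neighbour (not b) w))

    s-injective : Injective _≡_ _≡_ s
    s-injective {w} {w'} eq = unique (R-s w) (subst (λ a → R b a w') (sym eq) (R-s w'))

    unique⁻ : ∀ {w a} → R (not b) w a → a ≡ s w
    unique⁻ {w} {a} r' with w' , refl ← injective⇒surjective s-injective a =
      cong s (unique (R-s w') (unflip b r'))

    side : ∀ {z} → E Γ x z → z ≡ y ⊎ z ≡ s x
    side e with E⇒R b e
    ... | inj₁ r' = inj₁ (unique r' r)
    ... | inj₂ r' = inj₂ (unique⁻ r')

    valency≤2 : ⊥
    valency≤2 with f , inj , all , _ ← tet x with side (all 0F) | side (all 1F) | side (all 2F)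
    ... | inj₁ p | inj₁ q | _      with () ← inj (trans p (sym q))
    ... | inj₂ p | inj₂ q | _      with () ← inj (trans p (sym q))
    ... | inj₁ p | inj₂ _ | inj₁ q with () ← inj (trans p (sym q))
    ... | inj₁ _ | inj₂ p | inj₂ q with () ← inj (trans p (sym q))
    ... | inj₂ _ | inj₁ p | inj₁ q with () ← inj (trans p (sym q))
    ... | inj₂ p | inj₁ _ | inj₂ q with () ← inj (trans p (sym q))

  -- Three `b`-neighbours and the two opposite ones from `neighbour` and `other` would give valency
  -- five. In use, `y` is the vertex a walk has just left, and its continuation is unique.
  at-most-two : ∀ b {x y z w} → R b x y → R b x z → R b x w → y ≢ z → y ≢ w → z ≡ w
  at-most-two b {x} {y} {z} {w} ry rz rw y≢z y≢w with z ≟ w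
  ... | yes eq = eq
  ... | no z≢w = ⊥-elim five-neighbours
    where
    rp = proj₂ (neighbour (not b) x)
    rq = proj₁ (proj₂ (other (not b) rp))

    F : Fin 5 → V Γ
    F 0F = y
    F 1F = z
    F 2F = w
    F 3F = proj₁ (neighbour (not b) x)
    F 4F = proj₁ (other (not b) rp)

    F-E : ∀ i → E Γ x (F i)
    F-E 0F = R⇒E b ry
    F-E 1F = R⇒E b rz
    F-E 2F = R⇒E b rw
    F-E 3F = R⇒E (not b) rp
    F-E 4F = R⇒E (not b) rq

    separate : ∀ {a a'} → R b x a → R (not b) x a' → a ≢ a'
    separate r s refl = R-asym b r s

    five-neighbours : ⊥
    five-neighbours with f , inj , all , sur ← tet x
      with i , j , i<j , eq ← pigeonhole ≤-refl (λ i → proj₁ (sur (F i) (F-E i)))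
      with Feq ← trans (sym (proj₂ (sur (F i) (F-E i)))) (trans (cong f eq) (proj₂ (sur (F j) (F-E j))))
      with i | j | i<j
    ... | 0F | 1F | _ = y≢z Feq
    ... | 0F | 2F | _ = y≢w Feq
    ... | 0F | 3F | _ = separate ry rp Feq
    ... | 0F | 4F | _ = separate ry rq Feq
    ... | 1F | 2F | _ = z≢w Feq
    ... | 1F | 3F | _ = separate rz rp Feq
    ... | 1F | 4F | _ = separate rz rq Feq
    ... | 2F | 3F | _ = separate rw rp Feq
    ... | 2F | 4F | _ = separate rw rq Feq
    ... | 3F | 4F | _ = proj₂ (proj₂ (other (not b) rp)) Feq
    ... | 1F | 1F | s≤s ()
    ... | 2F | 1F | s≤s ()
    ... | 2F | 2F | s≤s (s≤s ())
    ... | 3F | 1F | s≤s ()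
    ... | 3F | 2F | s≤s (s≤s ())
    ... | 3F | 3F | s≤s (s≤s (s≤s ()))
    ... | 4F | 1F | s≤s ()
    ... | 4F | 2F | s≤s (s≤s ())
    ... | 4F | 3F | s≤s (s≤s (s≤s ()))
    ... | 4F | 4F | s≤s (s≤s (s≤s (s≤s ())))

  -- Alternating walks and the action of `G` on them.

  -- The first arc is traversed along D if b is true, against it otherwise.
  record Walk (b : Bool) (m : ℕ) (P : ℕ → V Γ) : Set where
    field
      arc  : ∀ {k} → k < m → R (dir b k) (P k) (P (suc k))
      turn : ∀ {k} → suc k < m → P k ≢ P (2 + k)

  -- Infinite walks need neither bounds nor indices modulo a length that is not yet known;
  -- periodicity is proved later. Finite `Walk`s remain because only they can be reversed.
  record Ray (b : Bool) (P : ℕ → V Γ) : Set where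
    field
      arc  : ∀ k → R (dir b k) (P k) (P (suc k))
      turn : ∀ k → P k ≢ P (2 + k)

  truncate : ∀ {b P} → Ray b P → ∀ m → Walk b m P
  truncate ray m = record { arc = λ {k} _ → Ray.arc ray k ; turn = λ {k} _ → Ray.turn ray k }

  tail : ∀ {b P} → Ray b P → Ray (not b) (P ∘ suc)
  tail ray = record { arc = λ k → Ray.arc ray (suc k) ; turn = λ k → Ray.turn ray (suc k) }

  drop : ∀ {b P} c → Ray b P → Ray (dir b c) (P ∘ (c +_))
  drop zero    ray = ray
  drop (suc c) ray = drop c (tail ray)

  drop-even : ∀ {b P} c → Ray b P → Ray b (P ∘ (c * 2 +_))
  drop-even {b} c ray = subst (λ d → Ray d _) (dir-even b c) (drop (c * 2) ray)

  arc-even : ∀ {b P} → Ray b P → ∀ i → R b (P (i * 2)) (P (suc (i * 2)))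
  arc-even {b} {P} ray i = subst (λ d → R d (P (i * 2)) (P (suc (i * 2)))) (dir-even b i) (Ray.arc ray (i * 2))

  arc-odd : ∀ {b P} → Ray b P → ∀ i → R (not b) (P (suc (i * 2))) (P (suc i * 2))
  arc-odd ray i = arc-even (tail ray) i

  map-ray : ∀ {b P g} → G g → Ray b P → Ray b (g ∘ P)
  map-ray {b} Gg ray = record
    { arc = λ k → G-preserves-R (dir b k) Gg (Ray.arc ray k)
    ; turn = λ k eq → Ray.turn ray k (G-injective Gg eq) }

  -- Abstract, because the unfolded terms of this recursion grow exponentially.
  abstract
    startRay : ∀ b {x y} → R b x y → ∃ λ P → Ray b P × P 0 ≡ x × P 1 ≡ y
    startRay b r = ray b r , record { arc = arcs b r ; turn = turns b r } , refl , refl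
      where
      ray : ∀ b {x y} → R b x y → ℕ → V Γ
      ray b {x} r zero    = x
      ray b     r (suc k) = ray (not b) (proj₁ (proj₂ (other (not b) (flip b r)))) k
      arcs : ∀ b {x y} (r : R b x y) k → R (dir b k) (ray b r k) (ray b r (suc k))
      arcs b r zero    = r
      arcs b r (suc k) = arcs (not b) _ k
      turns : ∀ b {x y} (r : R b x y) k → ray b r k ≢ ray b r (2 + k)
      turns b r zero    = proj₂ (proj₂ (other (not b) (flip b r)))
      turns b r (suc k) = turns (not b) _ k

  rayAt : ∀ b v → ∃ λ P → Ray b P × P 0 ≡ v × P 1 ≡ proj₁ (neighbour b v)
  rayAt b v = startRay b (proj₂ (neighbour b v))

  -- The length is even so that the reversed walk starts in the same direction `b` and `homogeneous`
  -- can compare the two.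
  reverse : ∀ {b P} → Ray b P → ∀ m → Walk b (m * 2) (λ k → P (m * 2 ∸ k))
  reverse {b} {P} ray m = record { arc = arcs ; turn = turns }
    where
    arcs : ∀ {k} → k < m * 2 → R (dir b k) (P (m * 2 ∸ k)) (P (m * 2 ∸ suc k))
    arcs {k} k<m = subst₂ (λ d i → R d (P i) (P j)) dirs (sym (+-∸-assoc 1 k<m)) (flip _ (Ray.arc ray j))
      where
      j = m * 2 ∸ suc k
      sum : k + suc j ≡ m * 2
      sum = trans (+-suc k j) (m+[n∸m]≡n k<m)
      -- `k` and `suc j` add up to an even number, so they flip `b` equally often modulo 2.
      dirs : not (dir b j) ≡ dir b k
      dirs = trans (sym (dir-not b j))
        (trans (cong (λ c → dir c (suc j)) (sym (trans (sym (dir-+ b k (suc j))) (trans (cong (dir b) sum) (dir-even b m)))))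
          (dir-involutive (dir b k) (suc j)))
    turns : ∀ {k} → suc k < m * 2 → P (m * 2 ∸ k) ≢ P (m * 2 ∸ (2 + k))
    turns {k} lt eq = Ray.turn ray (m * 2 ∸ (2 + k)) (sym (trans (cong P (sym (+-∸-assoc 2 lt))) eq))

  -- There are only two vertices to which a walk can go in the required direction, and `turn`
  -- excludes the one it came from; agreement on one arc therefore propagates.
  follow : ∀ {b m P Q g} → G g → Walk b m P → Walk b m Q → g (P 0) ≡ Q 0 → g (P 1) ≡ Q 1 →
           ∀ k → k < m → g (P k) ≡ Q k × g (P (suc k)) ≡ Q (suc k)
  follow Gg wP wQ e₀ e₁ zero _ = e₀ , e₁
  follow {b} {m} {P} {Q} {g} Gg wP wQ e₀ e₁ (suc k) k<m with follow Gg wP wQ e₀ e₁ k (<⇒≤ k<m)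
  ... | e , e' = e' , at-most-two (dir b (suc k))
      (subst (λ d → R d (Q (suc k)) (Q k)) (sym (dir-not b k)) (flip (dir b k) (Walk.arc wQ (<⇒≤ k<m))))
      (subst (λ a → R (dir b (suc k)) a (g (P (2 + k)))) e' (G-preserves-R (dir b (suc k)) Gg (Walk.arc wP k<m)))
      (Walk.arc wQ k<m)
      (λ eq → Walk.turn wP k<m (G-injective Gg (trans e eq)))
      (Walk.turn wQ k<m)

  homogeneous : ∀ {b m P Q} → Walk b (suc m) P → Walk b (suc m) Q →
                Σ _ λ g → G g × (∀ k → k ≤ suc m → g (P k) ≡ Q k)
  homogeneous {b} {m} {P} {Q} wP wQ
    with g , Gg , e₀ , e₁ ← R-transitive b (Walk.arc wP (s≤s z≤n)) (Walk.arc wQ (s≤s z≤n)) = g , Gg , agree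
    where
    agree : ∀ k → k ≤ suc m → g (P k) ≡ Q k
    agree zero    _  = e₀
    agree (suc k) le = proj₂ (follow Gg wP wQ e₀ e₁ k le)

  translate : ∀ {b P} → Ray b P → ∀ c m → Σ _ λ g → G g × (∀ k → k ≤ suc m → g (P k) ≡ P (c * 2 + k))
  translate r c m = homogeneous (truncate r _) (truncate (drop-even c r) _)

  reflect : ∀ {b P} → Ray b P → ∀ m → Σ _ λ g → G g × (∀ k → k ≤ suc m * 2 → g (P k) ≡ P (suc m * 2 ∸ k))
  reflect r m = homogeneous (truncate r _) (reverse r (suc m))

  -- If P 0 = P m with m odd, reflecting about m gives P (2m) = P 0, and translating by m + 1
  -- gives P (m + 1) = P (2m + 1); so the edge from P 0 to P (m + 1) carries both orientations.
  P0≢Podd : ∀ {b P} → Ray b P → ∀ s → P 0 ≢ P (suc (s * 2))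
  P0≢Podd {b} {P} r s eq = R-asym b forward backward
    where
    m = suc (s * 2)
    m*2 : m * 2 ≡ m + m
    m*2 = trans (*-comm m 2) (cong (m +_) (+-identityʳ m))
    P2m : P (m * 2) ≡ P 0
    P2m with g , Gg , h ← reflect r (s * 2) =
      trans (sym (h 0 z≤n)) (trans (cong g eq) (trans (h m (subst (m ≤_) (sym m*2) (m≤m+n m m)))
        (trans (cong P (trans (cong (_∸ m) m*2) (m+n∸n≡m m m))) (sym eq))))
    P2m+1 : P (suc (m * 2)) ≡ P (suc m)
    P2m+1 with g , Gg , h ← translate r (suc s) (s * 2) =
      trans (cong (P ∘ suc) m*2) (trans (sym (h m ≤-refl)) (trans (cong g (sym eq)) (trans (h 0 z≤n)
        (cong (P ∘ suc) (+-identityʳ m)))))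
    forward : R b (P 0) (P (suc m))
    forward = subst₂ (R b) P2m P2m+1 (arc-even r m)
    backward : R (not b) (P 0) (P (suc m))
    backward = subst (λ a → R (not b) a (P (suc m))) (sym eq) (arc-odd r s)

  odd-distance : ∀ {b P} → Ray b P → ∀ c s → P c ≢ P (c + suc (s * 2))
  odd-distance {P = P} r c s eq = P0≢Podd (drop c r) s (trans (cong P (+-identityʳ c)) eq)

  even≢odd : ∀ {b P} → Ray b P → ∀ i j → P (i * 2) ≢ P (suc (j * 2))
  even≢odd {P = P} r i j eq with i <? suc j
  ... | yes i≤j = odd-distance r (i * 2) (j ∸ i) (trans eq (cong P (sym index)))
    where
    index : i * 2 + suc ((j ∸ i) * 2) ≡ suc (j * 2)
    index = trans (+-suc (i * 2) _) (cong suc (trans (sym (*-distribʳ-+ 2 i (j ∸ i))) (cong (_* 2) (m+[n∸m]≡n (s≤s⁻¹ i≤j)))))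
  ... | no i≰j = odd-distance r (suc (j * 2)) (i ∸ suc j) (trans (sym eq) (cong P (sym index)))
    where
    index : suc (j * 2) + suc ((i ∸ suc j) * 2) ≡ i * 2
    index = trans (cong suc (+-suc (j * 2) _)) (trans (sym (*-distribʳ-+ 2 (suc j) (i ∸ suc j))) (cong (_* 2) (m+[n∸m]≡n (≮⇒≥ i≰j))))

  -- The translation by `i * 2` is realised by an injective element of `G`, so a repetition can be
  -- pulled back to the start of the ray.
  even-distance : ∀ {b P} → Ray b P → ∀ i j → i ≤ j → P (i * 2) ≡ P (j * 2) → P ((j ∸ i) * 2) ≡ P 0
  even-distance {P = P} r i j i≤j eq with g , Gg , h ← translate r i ((j ∸ i) * 2) =
    G-injective Gg (trans (h _ (m≤n+m _ 1)) (trans (cong P index) (trans (sym eq)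
      (trans (cong P (sym (+-identityʳ (i * 2)))) (sym (h 0 z≤n))))))
    where
    index : i * 2 + (j ∸ i) * 2 ≡ j * 2
    index = trans (sym (*-distribʳ-+ 2 i (j ∸ i))) (cong (_* 2) (m+[n∸m]≡n i≤j))

  -- Closing a ray up to an alternating cycle.

  altCycle : ∀ {P} → Ray true P → ∀ k → 1 ≤ k → P (suc k * 2) ≡ P 0 →
             (∀ j → 0 < j → j < suc k → P (j * 2) ≢ P 0) → AltCycle Γ G u₀ v₀ k
  altCycle {P} r k 1≤k return minimal = record
    { tl = tl ; hd = hd ; len≥4 = 1≤k
    ; tl-inj = wlog tl tails ; hd-inj = wlog hd heads
    ; tl≢hd = λ i j → even≢odd r (toℕ i) (toℕ j)
    ; out = λ i → arc-even r (toℕ i)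
    ; inn = inn }
    where
    tl hd : Fin (suc k) → V Γ
    tl i = P (toℕ i * 2)
    hd i = P (suc (toℕ i * 2))

    wlog : (f : Fin (suc k) → V Γ) → (∀ i j → toℕ i < toℕ j → f i ≢ f j) → Injective _≡_ _≡_ f
    wlog f f≢ {i} {j} eq with <-cmp (toℕ i) (toℕ j)
    ... | tri< lt _ _ = ⊥-elim (f≢ i j lt eq)
    ... | tri≈ _ e _ = toℕ-injective e
    ... | tri> _ _ gt = ⊥-elim (f≢ j i gt (sym eq))

    evens : ∀ i j → i < j → j < suc k → P (i * 2) ≢ P (j * 2)
    evens i j lt j<k eq = minimal (j ∸ i) (m<n⇒0<n∸m lt) (≤-<-trans (m∸n≤m j i) j<k) (even-distance r i j (<⇒≤ lt) eq)

    tails : ∀ i j → toℕ i < toℕ j → tl i ≢ tl j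
    tails i j lt = evens (toℕ i) (toℕ j) lt (toℕ<n j)

    heads : ∀ i j → toℕ i < toℕ j → hd i ≢ hd j
    -- A common head would have the in-neighbours `tl i`, `P (suc (toℕ i) * 2)` and `tl j`. The last
    -- two then coincide, against the distinctness of tails; if `j` directly follows `i`, `turn`
    -- suffices.
    heads i j lt eq with m≤n⇒m<n∨m≡n lt
    ... | inj₂ e = Ray.turn r (suc (toℕ i * 2)) (trans eq (cong (λ a → P (suc (a * 2))) (sym e)))
    ... | inj₁ lt' = evens (suc (toℕ i)) (toℕ j) lt' (toℕ<n j)
      (at-most-two false (arc-even r (toℕ i)) (arc-odd r (toℕ i))
        (subst (λ a → R false a (tl j)) (sym eq) (arc-even r (toℕ j)))
        (Ray.turn r (toℕ i * 2)) (tails i j lt))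

    inn : ∀ i → D (tl (next i)) (hd i)
    inn i with m≤n⇒m<n∨m≡n (toℕ<n i)
    ... | inj₁ lt = subst (λ a → D (P (a * 2)) (hd i))
        (sym (trans (toℕ-fromℕ< (m%n<n (suc (toℕ i)) (suc k))) (m<n⇒m%n≡m lt))) (arc-odd r (toℕ i))
    -- `i` is the last index, where `next` wraps around to 0 and `return` closes the cycle.
    ... | inj₂ e = subst (λ a → D a (hd i))
        (trans (trans (cong (λ a → P (a * 2)) e) return) (cong (λ a → P (a * 2)) (sym next≡0))) (arc-odd r (toℕ i))
      where
      next≡0 : toℕ (next i) ≡ 0
      next≡0 = trans (toℕ-fromℕ< (m%n<n (suc (toℕ i)) (suc k)))
        (trans (cong (λ a → a % suc k) e) (n%n≡0 (suc k)))

  -- Finiteness makes two even positions agree. Counting by `suc k` rules out the trivial return at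
  -- time 0.
  first-return : ∀ {P} → Ray true P → ∃ λ k → P (suc k * 2) ≡ P 0 × (∀ j → j < k → P (suc j * 2) ≢ P 0)
  first-return {P} r with i , j , i<j , eq ← pigeonhole ≤-refl (λ (i : Fin (suc n)) → P (toℕ i * 2))
    with toℕ j ∸ toℕ i in diff | m<n⇒0<n∸m i<j | even-distance r (toℕ i) (toℕ j) (<⇒≤ i<j) eq
  ... | suc d | _ | ret = least (λ k → P (suc k * 2) ≡ P 0) (λ k → P (suc k * 2) ≟ P 0) d ret

  -- Hexagons and the antipodal map.

  module Hexagons (rad : RadIs Γ G u₀ v₀ 3) (att : AttIs Γ G u₀ v₀ 2) where

    period-6-true : ∀ {P} → Ray true P → P 6 ≡ P 0 × P 1 ≢ P 5
    period-6-true {P} r with first-return r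
    ... | zero , ret , _ = ⊥-elim (Ray.turn r 0 (sym ret))
    ... | suc k , ret , minimal =
      of-length (suc k) ret (altCycle r (suc k) (s≤s z≤n) ret (λ { (suc j) _ j<k → minimal j (s≤s⁻¹ j<k) }))
        (λ _ → refl)
      where
      -- With `k` and `C` generalised, the equation from `rad` can be matched with `refl`; `hd≡`
      -- keeps the link between `C` and the ray.
      of-length : ∀ k → P (suc k * 2) ≡ P 0 → (C : AltCycle Γ G u₀ v₀ k) →
        (∀ i → AltCycle.hd C i ≡ P (suc (toℕ i * 2))) → P 6 ≡ P 0 × P 1 ≢ P 5
      of-length k ret C hd≡ with refl ← rad k C = ret , λ eq → 0≢2 (AltCycle.hd-inj C (trans (hd≡ 0F) (trans eq (sym (hd≡ 2F)))))
        where
        0≢2 : 0F ≢ 2F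
        0≢2 ()

    period-6 : ∀ {b P} → Ray b P → P 6 ≡ P 0
    period-6 {true} r = proj₁ (period-6-true r)
    -- The shifted ray has period 6, so `P 0`, `P 2` and `P 6` are all out-neighbours of `P 1`; as
    -- `P 2` differs from the other two, these coincide.
    period-6 {false} {P} r with P7≡P1 , P2≢P6 ← period-6-true (tail r) =
      sym (at-most-two true (Ray.arc r 1) (Ray.arc r 0)
        (subst (λ a → D a (P 6)) P7≡P1 (Ray.arc r 6)) (λ eq → Ray.turn r 0 (sym eq)) P2≢P6)

    P0≢P4 : ∀ {b P} → Ray b P → P 0 ≢ P 4
    P0≢P4 r eq = Ray.turn r 4 (sym (trans (period-6 r) eq))

    hexagon : ∀ {P} → Ray true P → AltCycle Γ G u₀ v₀ 2
    hexagon r = altCycle r 2 (s≤s z≤n) (period-6 r) λ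
      { 1 _ _ eq → Ray.turn r 0 (sym eq)
      ; 2 _ _ eq → P0≢P4 r (sym eq)
      ; (suc (suc (suc _))) _ (s≤s (s≤s (s≤s ()))) }

    On : (ℕ → V Γ) → V Γ → Set
    On P w = ∃ λ (a : Fin 6) → P (toℕ a) ≡ w

    ≤6 : ∀ (a : Fin 6) → toℕ a ≤ 6
    ≤6 a = <⇒≤ (toℕ<n a)

    On-reverse : ∀ {b P} → Ray b P → ∀ a → On P (P (6 ∸ toℕ {6} a))
    On-reverse r 0F = 0F , sym (period-6 r)
    On-reverse r 1F = 5F , refl
    On-reverse r 2F = 4F , refl
    On-reverse r 3F = 3F , refl
    On-reverse r 4F = 2F , refl
    On-reverse r 5F = 1F , refl

    -- `g` sends `Q 1` to `Q 1` or to `Q 5`, so it fixes the hexagon pointwise or reflects it in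
    -- `Q 0`.
    stabiliser-preserves-On : ∀ {b Q g} → Ray b Q → G g → g (Q 0) ≡ Q 0 → ∀ {w} → On Q w → On Q (g w)
    stabiliser-preserves-On {b} {Q} {g} r Gg fix (c , refl) with g (Q 1) ≟ Q 1
    ... | yes e = c , sym (proj₁ (follow Gg (truncate r 6) (truncate r 6) fix e (toℕ c) (toℕ<n c)))
    ... | no e = subst (On Q) (sym (proj₁ (follow Gg (truncate r 6) (reverse r 3)
        (trans fix (sym (period-6 r))) (sym g1≡5) (toℕ c) (toℕ<n c)))) (On-reverse r c)
      where
      g1≡5 : Q 5 ≡ g (Q 1)
      g1≡5 = at-most-two b (Ray.arc r 0)
        (subst (λ a → R b a (Q 5)) (period-6 r) (Walk.arc (reverse r 3) (s≤s z≤n)))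
        (subst (λ a → R b a (g (Q 1))) fix (G-preserves-R b Gg (Ray.arc r 0)))
        (P0≢P4 (tail r)) (λ eq → e (sym eq))

    -- The reflection of the hexagon P in P 0 also preserves the hexagon Q, so it fixes the second
    -- common vertex; its only fixed vertices are P 0 and P 3.
    second-common-vertex : ∀ {b P Q} → Ray b P → Ray (not b) Q → P 0 ≡ Q 0 → ∀ {w} → On P w → On Q w → w ≢ P 0 →
      (∀ w' → On P w' → On Q w' → w' ≢ P 0 → w' ≡ w) → w ≡ P 3
    second-common-vertex {b} {P} {Q} r s P0≡Q0 {w} (a , refl) onQ w≢ unique
      with g , Gg , h ← reflect r 2 = conclude a w≢ (trans (sym (h (toℕ a) (≤6 a))) fixed)
      where
      fix : g (P 0) ≡ P 0
      fix = trans (h 0 z≤n) (period-6 r)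
      fixed : g w ≡ w
      fixed = unique (g w)
        (subst (On P) (sym (h (toℕ a) (≤6 a))) (On-reverse r a))
        (stabiliser-preserves-On s Gg (trans (cong g (sym P0≡Q0)) (trans fix P0≡Q0)) onQ)
        (λ eq → w≢ (G-injective Gg (trans eq (sym fix))))
      conclude : ∀ (a : Fin 6) → P (toℕ a) ≢ P 0 → P (6 ∸ toℕ a) ≡ P (toℕ a) → P (toℕ a) ≡ P 3
      conclude 0F w≢ eq = ⊥-elim (w≢ refl)
      conclude 1F w≢ eq = ⊥-elim (P0≢P4 (tail r) (sym eq))
      conclude 2F w≢ eq = ⊥-elim (Ray.turn r 2 (sym eq))
      conclude 3F w≢ eq = refl
      conclude 4F w≢ eq = ⊥-elim (Ray.turn r 2 eq)
      conclude 5F w≢ eq = ⊥-elim (P0≢P4 (tail r) eq)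

    antipodes : ∀ {P Q} → Ray true P → Ray false Q → P 0 ≡ Q 0 →
      P 3 ≡ Q 3 × (∀ w → On P w → On Q w → w ≡ P 0 ⊎ w ≡ P 3)
    antipodes {P} {Q} r s P0≡Q0 = trans (sym w≡P3) w≡Q3 , only
      where
      C  = hexagon r
      -- An `AltCycle` begins at a tail, but `Q 0` is a head; the shift by one makes `Q 0` the last
      -- head, `Q 6`.
      C' = hexagon (tail s)

      to : ∀ {w} → OnCycle Γ G u₀ v₀ C w → On P w
      to (0F , inj₁ e) = 0F , e
      to (1F , inj₁ e) = 2F , e
      to (2F , inj₁ e) = 4F , e
      to (0F , inj₂ e) = 1F , e
      to (1F , inj₂ e) = 3F , e
      to (2F , inj₂ e) = 5F , e

      from : ∀ {w} → On P w → OnCycle Γ G u₀ v₀ C w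
      from (0F , e) = 0F , inj₁ e
      from (1F , e) = 0F , inj₂ e
      from (2F , e) = 1F , inj₁ e
      from (3F , e) = 1F , inj₂ e
      from (4F , e) = 2F , inj₁ e
      from (5F , e) = 2F , inj₂ e

      to' : ∀ {w} → OnCycle Γ G u₀ v₀ C' w → On Q w
      to' (0F , inj₁ e) = 1F , e
      to' (1F , inj₁ e) = 3F , e
      to' (2F , inj₁ e) = 5F , e
      to' (0F , inj₂ e) = 2F , e
      to' (1F , inj₂ e) = 4F , e
      to' (2F , inj₂ e) = 0F , trans (sym (period-6 s)) e

      from' : ∀ {w} → On Q w → OnCycle Γ G u₀ v₀ C' w
      from' (0F , e) = 2F , inj₂ (trans (period-6 s) e)
      from' (1F , e) = 0F , inj₁ e
      from' (2F , e) = 0F , inj₂ e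
      from' (3F , e) = 1F , inj₁ e
      from' (4F , e) = 1F , inj₂ e
      from' (5F , e) = 2F , inj₁ e

      tl≢P0 : ∀ i → AltCycle.tl C' i ≢ P 0
      tl≢P0 i e = AltCycle.tl≢hd C' i 2F (trans e (trans P0≡Q0 (sym (period-6 s))))

      Common : V Γ → Set
      Common w = OnCycle Γ G u₀ v₀ C w × OnCycle Γ G u₀ v₀ C' w

      common : HasSize Common 2
      common = att 2 2 C C'
        -- The cycles differ because `P 0` is a tail of an arc in `C` and a head in `C'`.
        (P 0 , P 1 , (0F , inj₁ (refl , refl)) ,
          λ { (i , inj₁ (e , _)) → tl≢P0 i e ; (i , inj₂ (e , _)) → tl≢P0 (next i) e })
        (P 0 , from (0F , refl) , from' (0F , sym P0≡Q0))

      second : ∃ λ w → Common w × w ≢ P 0 × (∀ w' → Common w' → w' ≢ P 0 → w' ≡ w)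
      second with f , inj , all , sur ← common
        with sur (P 0) (from (0F , refl) , from' (0F , sym P0≡Q0))
      ... | 0F , e = f 1F , all 1F , (λ e' → 1≢0 (inj (trans e' (sym e)))) , unique
        where
        1≢0 : 1F ≢ 0F
        1≢0 ()
        unique : ∀ w' → Common w' → w' ≢ P 0 → w' ≡ f 1F
        unique w' c ne with sur w' c
        ... | 0F , e' = ⊥-elim (ne (trans (sym e') e))
        ... | 1F , e' = sym e'
      ... | 1F , e = f 0F , all 0F , (λ e' → 0≢1 (inj (trans e' (sym e)))) , unique
        where
        0≢1 : 0F ≢ 1F
        0≢1 ()
        unique : ∀ w' → Common w' → w' ≢ P 0 → w' ≡ f 0F
        unique w' c ne with sur w' c
        ... | 0F , e' = sym e'
        ... | 1F , e' = ⊥-elim (ne (trans (sym e') e))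

      w = proj₁ second
      onP = to (proj₁ (proj₁ (proj₂ second)))
      onQ = to' (proj₂ (proj₁ (proj₂ second)))
      w≢P0 = proj₁ (proj₂ (proj₂ second))

      unique : ∀ w' → On P w' → On Q w' → w' ≢ P 0 → w' ≡ w
      unique w' p q = proj₂ (proj₂ (proj₂ second)) w' (from p , from' q)

      w≡P3 : w ≡ P 3
      w≡P3 = second-common-vertex r s P0≡Q0 onP onQ w≢P0 unique

      w≡Q3 : w ≡ Q 3
      w≡Q3 = second-common-vertex s r (sym P0≡Q0) onQ onP (λ e → w≢P0 (trans e (sym P0≡Q0)))
        (λ w' q p ne → unique w' p q (λ e → ne (trans e P0≡Q0)))

      only : ∀ w' → On P w' → On Q w' → w' ≡ P 0 ⊎ w' ≡ P 3
      only w' p q with w' ≟ P 0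
      ... | yes e = inj₁ e
      ... | no ne = inj₂ (trans (unique w' p q ne) w≡P3)

    σ : V Γ → V Γ
    σ v = proj₁ (rayAt true v) 3

    -- Independence of the ray chosen in `σ`. Since `antipodes` compares only rays of opposite
    -- directions, a `true` ray is compared with the chosen one through a `false` ray.
    σ-ray : ∀ {b P} → Ray b P → σ (P 0) ≡ P 3
    σ-ray {false} {P} r with _ , s , e , _ ← rayAt true (P 0) = proj₁ (antipodes s r e)
    σ-ray {true} {P} r with Q , s , e , _ ← rayAt false (P 0) =
      trans (cong σ (sym e)) (trans (σ-ray s) (sym (proj₁ (antipodes r s (sym e)))))

    σ-involutive : ∀ v → σ (σ v) ≡ v
    σ-involutive v with P , r , e , _ ← rayAt true v = trans (σ-ray (drop 3 r)) (trans (period-6 r) e)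

    σ≢ : ∀ v → σ v ≢ v
    σ≢ v eq with P , r , e , _ ← rayAt true v = P0≢Podd r 1 (trans e (sym eq))

    σ-commutes : ∀ {g} → G g → ∀ v → g (σ v) ≡ σ (g v)
    σ-commutes {g} Gg v with P , r , e , _ ← rayAt true v =
      sym (trans (cong (σ ∘ g) (sym e)) (σ-ray (map-ray Gg r)))

    -- Along a ray σ is the shift by 3, which is odd and so exchanges tails and heads.
    σ-reverses-D : ∀ {u v} → D u v → D (σ v) (σ u)
    σ-reverses-D d with P , r , refl , refl ← startRay true d =
      subst₂ D (sym (σ-ray (tail r))) (sym (σ-ray r)) (Ray.arc r 3)

    ¬R-σ : ∀ b {u} → ¬ R b u (σ u)
    ¬R-σ b d with P , r , refl , P1≡ ← startRay b d = Ray.turn r 1 (trans P1≡ (σ-ray r))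

    ¬E-σ : ∀ u → ¬ E Γ u (σ u)
    ¬E-σ u e = [ ¬R-σ true , ¬R-σ false ] (E⇒D e)

    -- The out-neighbours of `P 0` are `P 1` and `P 5`, while `σ v` is `P 4`.
    ¬D-σ-common : ∀ {u v} → D u v → ¬ D u (σ v)
    ¬D-σ-common d d' with P , r , refl , refl ← startRay true d =
      odd-distance r 4 0 (trans (sym (σ-ray (tail r))) (sym (at-most-two true d
        (subst (λ a → D a (P 5)) (period-6 r) (Ray.arc r 5)) d'
        (P0≢P4 (tail r)) (λ e → σ≢ (P 1) (sym e)))))

    -- `σ v` would be `P 4` on one hexagon through `u` and `Q 1` on the other, hence a common vertex
    -- different from `P 0` and `P 3`.
    ¬D-D-σ : ∀ {u v} → D u v → ¬ D (σ v) u
    ¬D-D-σ {u} {v} d d'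
      with P , r , refl , refl ← startRay true d
      with Q , s , P0≡Q0 , Q1≡ ← startRay false d'
      = [ (λ eq → P0≢P4 r (trans (sym eq) (σ-ray (tail r))))
        , (λ eq → odd-distance r 3 0 (trans (sym eq) (σ-ray (tail r)))) ]
        (proj₂ (antipodes r s (sym P0≡Q0)) (σ v) (4F , sym (σ-ray (tail r))) (1F , Q1≡))

    ¬E-σ-common : ∀ {u v} → E Γ u v → ¬ E Γ u (σ v)
    ¬E-σ-common {u} {v} e e' with E⇒D e | E⇒D e'
    ... | inj₁ d | inj₁ d' = ¬D-σ-common d d'
    ... | inj₂ d | inj₂ d' = ¬D-σ-common (σ-reverses-D d) (σ-reverses-D d')
    ... | inj₁ d | inj₂ d' = ¬D-D-σ d d'
    ... | inj₂ d | inj₁ d' = ¬D-D-σ d' (subst (λ a → D a u) (sym (σ-involutive v)) d)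

-- The quotient by σ, the group induced on it, and its complements.

module Quotient (Γ : Graph) (G : (V Γ → V Γ) → Set) (sub : IsSubgroupAut Γ G)
  (connected : Connected Γ) (¬bipartite : ¬ Bipartite Γ)
  (D : V Γ → V Γ → Set)
  (D⇒E : ∀ {u v} → D u v → E Γ u v) (E⇒D : ∀ {u v} → E Γ u v → D u v ⊎ D v u)
  (D-asym : ∀ {u v} → D u v → ¬ D v u)
  (G-preserves-D : ∀ {g} → G g → ∀ {u v} → D u v → D (g u) (g v))
  (D-transitive : ∀ {u v u' v'} → D u v → D u' v' → Σ _ λ g → G g × g u ≡ u' × g v ≡ v')
  (base : V Γ) (successor : ∀ u → ∃ (D u))
  (σ : V Γ → V Γ) (σσ : ∀ u → σ (σ u) ≡ u) (σ≢ : ∀ u → σ u ≢ u)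
  (σ-commutes : ∀ {g} → G g → ∀ u → g (σ u) ≡ σ (g u))
  (σ-reverses-D : ∀ {u v} → D u v → D (σ v) (σ u))
  (¬E-σ : ∀ u → ¬ E Γ u (σ u)) (¬E-σ-common : ∀ {u v} → E Γ u v → ¬ E Γ u (σ v)) where

  open Graph Γ using (n; adj)
  open IsSubgroupAut sub
  open FreeInvolution σ σσ σ≢

  E-sym : ∀ {u v} → E Γ u v → E Γ v u
  E-sym {u} {v} e = trans (Graph.sym Γ v u) e

  σ-E : ∀ {u v} → E Γ u v → E Γ (σ u) (σ v)
  σ-E e with E⇒D e
  ... | inj₁ d = E-sym (D⇒E (σ-reverses-D d))
  ... | inj₂ d = D⇒E (σ-reverses-D d)

  EdgeOver : Fin size → Fin size → Set
  EdgeOver x y = ∃ λ u → ∃ λ v → p u ≡ x × p v ≡ y × E Γ u v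

  EdgeOver? : ∀ x y → Dec (EdgeOver x y)
  EdgeOver? x y = any? λ u → any? λ v → (p u ≟ x) ×-dec (p v ≟ y) ×-dec (adj u v ≟ᵇ true)

  EdgeOver-sym : ∀ {x y} → EdgeOver x y → EdgeOver y x
  EdgeOver-sym (u , v , pu , pv , e) = v , u , pv , pu , E-sym e

  EdgeOver-irrefl : ∀ {x} → ¬ EdgeOver x x
  EdgeOver-irrefl (u , v , pu , pv , e) with p-fibre v u (trans pv (sym pu))
  ... | inj₁ refl = false≢true (trans (sym (Graph.irrefl Γ u)) e)
  ... | inj₂ refl = ¬E-σ u e

  Γ' : Graph
  Γ' = record
    { n = size
    ; adj = λ x y → does (EdgeOver? x y)
    ; sym = λ x y → true⇔⇒≡
        (λ e → ⇒does≡true (EdgeOver? y x) (EdgeOver-sym (does≡true⇒ (EdgeOver? x y) e)))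
        (λ e → ⇒does≡true (EdgeOver? x y) (EdgeOver-sym (does≡true⇒ (EdgeOver? y x) e)))
    ; irrefl = λ x → ¬-not λ e → EdgeOver-irrefl (does≡true⇒ (EdgeOver? x x) e) }

  edgeOver : ∀ {x y} → E Γ' x y → EdgeOver x y
  edgeOver {x} {y} = does≡true⇒ (EdgeOver? x y)

  p-hom : ∀ {u v} → E Γ u v → E Γ' (p u) (p v)
  p-hom {u} {v} e = ⇒does≡true (EdgeOver? (p u) (p v)) (u , v , refl , refl , e)

  -- If the edge upstairs points the wrong way, its image under σ points the right way. This is what
  -- turns `D-transitive` into arc-transitivity of `H`.
  arcOver : ∀ {x y} → E Γ' x y → ∃ λ u → ∃ λ v → p u ≡ x × p v ≡ y × D u v
  arcOver e' with u , v , pu , pv , e ← edgeOver e' with E⇒D e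
  ... | inj₁ d = u , v , pu , pv , d
  ... | inj₂ d = σ u , σ v , trans (p-σ u) pu , trans (p-σ v) pv , σ-reverses-D d

  p-locally-injective : ∀ {u v w} → E Γ u v → E Γ u w → p v ≡ p w → v ≡ w
  p-locally-injective {u} {v} {w} e e' eq with p-fibre v w eq
  ... | inj₁ v≡w  = v≡w
  ... | inj₂ refl = ⊥-elim (¬E-σ-common e' e)

  covering : IsCovering Γ Γ' p
  covering = record
    { surj = λ x → rep x , p-rep x
    ; hom = λ _ _ → p-hom
    ; locInj = λ _ _ _ → p-locally-injective
    ; locSurj = locSurj }
    where
    locSurj : ∀ u y → E Γ' (p u) y → ∃ λ v → E Γ u v × p v ≡ y
    locSurj u y e' with a , b , pa , pb , e ← edgeOver e' with p-fibre a u pa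
    ... | inj₁ refl = b , e , pb
    ... | inj₂ refl = σ b , subst (λ c → E Γ c (σ b)) (σσ u) (σ-E e) , trans (p-σ b) pb

  connected' : Connected Γ'
  connected' x y = subst₂ (Reach Γ') (p-rep x) (p-rep y) (push (connected (rep x) (rep y)))
    where
    push : ∀ {u v} → Reach Γ u v → Reach Γ' (p u) (p v)
    push here = here
    push (there e r) = there (p-hom e) (push r)

  G-fibre : ∀ {g} → G g → ∀ u v → p u ≡ p v → p (g u) ≡ p (g v)
  G-fibre {g} Gg u v eq with p-fibre u v eq
  ... | inj₁ refl = refl
  ... | inj₂ refl = trans (cong p (σ-commutes Gg v)) (p-σ (g v))

  H : (V Γ' → V Γ') → Set
  H h = Σ _ λ g → G g × (p ∘ g) ≗ (h ∘ p)

  induced : (V Γ → V Γ) → V Γ' → V Γ'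
  induced g x = p (g (rep x))

  induced-H : ∀ {g} → G g → (p ∘ g) ≗ (induced g ∘ p)
  induced-H Gg u = G-fibre Gg u (rep (p u)) (sym (p-rep (p u)))

  H-inverse : ∀ {g k h l} → (k ∘ g) ≗ id → (p ∘ g) ≗ (h ∘ p) → (p ∘ k) ≗ (l ∘ p) → (l ∘ h) ≗ id
  H-inverse {g} {k} {h} {l} kg ph pl x =
    trans (cong (l ∘ h) (sym (p-rep x))) (trans (cong l (sym (ph (rep x))))
      (trans (sym (pl (g (rep x)))) (trans (cong p (kg (rep x))) (p-rep x))))

  H-preserves-E : ∀ h → H h → ∀ {x y} → E Γ' x y → E Γ' (h x) (h y)
  H-preserves-E h (g , Gg , ph) e' with u , v , refl , refl , e ← edgeOver e' =
    subst₂ (E Γ') (ph u) (ph v) (p-hom (trans (proj₂ (proj₂ (proj₂ (auts g Gg))) u v) e))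

  H-closedInv : ∀ h → H h → Σ _ λ l → H l × (l ∘ h) ≗ id × (h ∘ l) ≗ id
  H-closedInv h (g , Gg , ph) with k , Gk , kg , gk ← closedInv g Gg =
    induced k , (k , Gk , induced-H Gk) ,
    H-inverse {g} {k} {h} {induced k} kg ph (induced-H Gk) , H-inverse {k} {g} {induced k} {h} gk (induced-H Gk) ph

  H-subgroup : IsSubgroupAut Γ' H
  H-subgroup = record
    { auts = H-auts
    ; respect = λ h l h≗l (g , Gg , ph) → g , Gg , λ u → trans (ph u) (h≗l (p u))
    ; hasId = id , hasId , λ _ → refl
    ; closed∘ = λ h l (g , Gg , ph) (k , Gk , pl) →
        g ∘ k , closed∘ g k Gg Gk , λ u → trans (ph (k u)) (cong h (pl u))
    ; closedInv = H-closedInv }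
    where
    H-auts : ∀ h → H h → IsAut Γ' h
    H-auts h Hh with l , Hl , lh , hl ← H-closedInv h Hh =
      l , lh , hl , λ x y → true⇔⇒≡
        (λ e → subst₂ (E Γ') (lh x) (lh y) (H-preserves-E l Hl e))
        (H-preserves-E h Hh)

  H-arcTransitive : ArcTransitive Γ' H
  H-arcTransitive x y x' y' e e'
    with u , v , refl , refl , d ← arcOver e
    with u' , v' , refl , refl , d' ← arcOver e'
    with g , Gg , refl , refl ← D-transitive d d' =
    induced g , (g , Gg , induced-H Gg) , sym (induced-H Gg u) , sym (induced-H Gg v)

  lifts : Lifts Γ Γ' p H
  lifts h (g , Gg , ph) = g , auts g Gg , ph

  -- Suppose `g u` is `σ u` and take an arc from `u` to `v`. If `g` fixes `v`, then `v` is adjacent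
  -- to both `u` and `σ u`; if not, `g` acts on the arc as σ does and reverses the orientation.
  G∩CT-trivial : ∀ g → G g → CT Γ Γ' p g → g ≗ id
  G∩CT-trivial g Gg (_ , pg) u with p-fibre (g u) u (pg u)
  ... | inj₁ eq = eq
  ... | inj₂ gu≡σu with v , d ← successor u with p-fibre (g v) v (pg v)
  ...   | inj₁ gv≡v = ⊥-elim (¬E-σ-common (E-sym (D⇒E d))
          (E-sym (D⇒E (subst₂ D gu≡σu gv≡v (G-preserves-D Gg d)))))
  ...   | inj₂ gv≡σv = ⊥-elim (D-asym (subst₂ D gu≡σu gv≡σv (G-preserves-D Gg d)) (σ-reverses-D d))

  G-complement : IsComplement Γ Γ' p H G
  G-complement = sub , (λ g Gg → auts g Gg , induced g , (g , Gg , induced-H Gg) , induced-H Gg) ,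
    G∩CT-trivial , factor
    where
    factor : ∀ a → Lifted Γ Γ' p H a → Σ _ λ k → Σ _ λ c → G k × CT Γ Γ' p c × a ≗ (k ∘ c)
    -- `a` and `g` lie over the same `h`, so `k ∘ a`, with `k` inverse to `g`, lies over the
    -- identity.
    factor a ((a' , a'a , aa' , a-adj) , h , (g , Gg , pg) , pa) with k , Gk , kg , gk ← closedInv g Gg =
      g , k ∘ a , Gg ,
      ((a' ∘ g , (λ u → trans (cong a' (gk (a u))) (a'a u)) , (λ u → trans (cong k (aa' (g u))) (kg u)) ,
        λ u v → trans (proj₂ (proj₂ (proj₂ (auts k Gk))) (a u) (a v)) (a-adj u v)) ,
        λ u → trans (G-fibre Gk (a u) (g u) (trans (pa u) (sym (pg u)))) (cong p (kg u))) ,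
      λ u → sym (gk (a u))

  -- H is arc-transitive, so either every arc starting in an invariant section S ends in S,
  -- and S is everything by connectedness, or none does, and S is one half of a bipartition.
  ¬sectional : ∀ K → IsComplement Γ Γ' p H K → ¬ Sectional Γ Γ' p H K
  ¬sectional K (K-sub , _ , _ , factor) (S , S-invariant , S-size) = contradiction
    where
    sec : V Γ' → V Γ
    sec x = proj₁ (S-size x) 0F

    sec-S : ∀ x → S (sec x)
    sec-S x = proj₁ (proj₁ (proj₂ (proj₂ (S-size x))) 0F)

    p-sec : ∀ x → p (sec x) ≡ x
    p-sec x = proj₂ (proj₁ (proj₂ (proj₂ (S-size x))) 0F)

    S-unique : ∀ {u v} → S u → S v → p u ≡ p v → u ≡ v
    S-unique {u} {v} su sv eq
      with proj₂ (proj₂ (proj₂ (S-size (p v)))) u (su , eq) | proj₂ (proj₂ (proj₂ (S-size (p v)))) v (sv , refl)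
    ... | 0F , e | 0F , e' = trans (sym e) e'

    -- `S` is an arbitrary predicate; it is decided by comparing `u` with the one member of `S` in
    -- its fibre.
    S? : ∀ u → Dec (S u)
    S? u with sec (p u) ≟ u
    ... | yes e = yes (subst S e (sec-S (p u)))
    ... | no ne = no λ su → ne (S-unique (sec-S (p u)) su (p-sec (p u)))

    ¬S⇒Sσ : ∀ {u} → ¬ S u → S (σ u)
    ¬S⇒Sσ {u} ¬su with p-fibre (sec (p u)) u (p-sec (p u))
    ... | inj₁ e = ⊥-elim (¬su (subst S e (sec-S (p u))))
    ... | inj₂ e = subst S e (sec-S (p u))

    -- Some `h` in `H` carries the image of one arc to that of the other, and so does the factor `k`
    -- in `K` of its lift. Invariance of `S` gives `k u ≡ u'`, and local injectivity then gives
    -- `k v ≡ v'`.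
    S-arcs : ∀ {u v u' v'} → S u → S u' → E Γ u v → E Γ u' v' → S v → S v'
    S-arcs {u} {v} {u'} {v'} su su' e e' sv
      with h , Hh , hu , hv ← H-arcTransitive (p u) (p v) (p u') (p v') (p-hom e) (p-hom e')
      with a , a-aut , pa ← lifts h Hh
      with k , c , Kk , ((c' , c'c , cc' , _) , pc) , a≗kc ← factor a (a-aut , h , Hh , pa) =
      subst S kv≡v' (S-invariant k v Kk sv)
      where
      pk : ∀ w → p (k w) ≡ h (p w)
      pk w = trans (cong (p ∘ k) (sym (cc' w))) (trans (cong p (sym (a≗kc (c' w))))
        (trans (pa (c' w)) (cong h (trans (sym (pc (c' w))) (cong p (cc' w))))))
      ku≡u' : k u ≡ u'
      ku≡u' = S-unique (S-invariant k u Kk su) su' (trans (pk u) hu)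
      kv≡v' : k v ≡ v'
      kv≡v' = p-locally-injective
        (subst (λ w → E Γ w (k v)) ku≡u'
          (trans (proj₂ (proj₂ (proj₂ (IsSubgroupAut.auts K-sub k Kk))) u v) e))
        e' (trans (pk v) hv)

    x₀ = p base
    u₁ = sec x₀
    v₁ = proj₁ (successor u₁)
    e₁ = D⇒E (proj₂ (successor u₁))

    contradiction : ⊥
    contradiction with S? v₁
    -- `S` would contain both `u₁` and `σ u₁`, which share a fibre.
    ... | yes sv = σ≢ u₁ (S-unique (everything (connected u₁ (σ u₁)) (sec-S x₀)) (sec-S x₀) (p-σ u₁))
      where
      everything : ∀ {u w} → Reach Γ u w → S u → S w
      everything here su = su
      everything (there e r) su = everything r (S-arcs (sec-S x₀) su e₁ e sv)
    ... | no ¬sv = ¬bipartite ((λ u → does (S? u)) , proper)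
      where
      independent : ∀ {u v} → E Γ u v → S u → ¬ S v
      independent e su sv = ¬sv (S-arcs su (sec-S x₀) e e₁ sv)
      proper : ∀ u v → E Γ u v → does (S? u) ≢ does (S? v)
      proper u v e eq with S? u | S? v
      ... | yes su | yes sv = independent e su sv
      -- The complement of `S` is its image under σ, so it is independent as well.
      ... | no ¬su | no ¬sv' = independent (σ-E e) (¬S⇒Sσ ¬su) (¬S⇒Sσ ¬sv')
      ... | yes _ | no _ = false≢true (sym eq)
      ... | no _ | yes _ = false≢true eq

theorem4p1 : (Γ : Graph) (G : (V Γ → V Γ) → Set) →
    IsSubgroupAut Γ G → Connected Γ → ¬ Bipartite Γ → Tetravalent Γ →
    HalfArcTransitive Γ G → 12 < Order Γ →
    (∀ u₀ v₀ → E Γ u₀ v₀ → RadIs Γ G u₀ v₀ 3 × AttIs Γ G u₀ v₀ 2) →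
    Σ Graph λ Γ' → Σ (V Γ → V Γ') λ p → Σ ((V Γ' → V Γ') → Set) λ H →
    Connected Γ' × IsCovering Γ Γ' p × NFold Γ Γ' p 2 ×
    IsSubgroupAut Γ' H × ArcTransitive Γ' H ×
    Lifts Γ Γ' p H × NonSectionalSplit Γ Γ' p H
theorem4p1 Γ G sub connected ¬bipartite tet hat order rad-att =
  Γ' , p , H , connected' , covering , fibre-size , H-subgroup , H-arcTransitive , lifts ,
  (G , G-complement) , ¬sectional
  where
  u₀ : V Γ
  u₀ = fromℕ< (≤-trans (s≤s z≤n) order)

  v₀ : V Γ
  v₀ = proj₁ (tet u₀) 0F

  e₀ : E Γ u₀ v₀
  e₀ = proj₁ (proj₂ (proj₂ (tet u₀))) 0F

  open Orientation Γ G sub tet hat u₀ v₀ e₀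
  open Hexagons (proj₁ (rad-att u₀ v₀ e₀)) (proj₂ (rad-att u₀ v₀ e₀))
  module Q = Quotient Γ G sub connected ¬bipartite D D⇒E E⇒D D-asym G-preserves-D D-transitive
    u₀ (neighbour true) σ σ-involutive σ≢ σ-commutes σ-reverses-D ¬E-σ ¬E-σ-common
  open Q using (Γ'; H; connected'; covering; H-subgroup; H-arcTransitive; lifts; G-complement; ¬sectional)
  open FreeInvolution σ σ-involutive σ≢ using (p; fibre-size)
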